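{- For every integer $r\geqslant 2$ there are infinitely many primitive covering numbers having exactly $r$ distinct prime divisors.
   Context: For $a\in\mathbb{Z}$ and a positive integer $n$, $a(\mathrm{mod}\ n)=\{a+nx: x\in\mathbb{Z}\}$ is the residue class with modulus $n$. A finite system of residue classes $\{a_i(\mathrm{mod}\ n_i)\}_{i=1}^k$ is a cover of $\mathbb{Z}$ if every integer lies in at least one of the classes $a_i(\mathrm{mod}\ n_i)$. A positive integer $n$ is called a covering number if there is a cover of $\mathbb{Z}$ whose moduli are all distinct, greater than one, and divisors of $n$. A covering number is called a primitive covering number if none of its proper divisors (positive divisors smaller than the number itself) is a covering number. -}

module Defs where

import Data.Integer as ℤ
open import Data.Integer using (ℤ; +_)
open import Data.List using (List; length; map)
open import Data.List.Membership.Propositional using (_∈_)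
open import Data.List.Relation.Unary.All using (All)
open import Data.List.Relation.Unary.Any using (Any)
open import Data.List.Relation.Unary.Unique.Propositional using (Unique)
open import Data.Nat using (ℕ; _<_)
open import Data.Nat.Divisibility using (_∣_)
open import Data.Nat.Primality using (Prime)
open import Data.Product using (_×_; ∃-syntax)
open import Function using (_⇔_)
open import Relation.Binary.PropositionalEquality using (_≡_)
open import Relation.Nullary using (¬_)

record ResidueClass : Set where
  constructor residueClass
  field
    residue    : ℤ
    modulus    : ℕ
    modulus>0  : 0 < modulus

open ResidueClass public

infix 4 _∈ᶜ_

_∈ᶜ_ : ℤ → ResidueClass → Set
z ∈ᶜ c = ∃[ x ] z ≡ residue c ℤ.+ (+ modulus c) ℤ.* x

System : Set
System = List ResidueClass

moduli : System → List ℕ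
moduli = map modulus

IsCover : System → Set
IsCover s = ∀ (z : ℤ) → Any (z ∈ᶜ_) s

record CoveringNumber (n : ℕ) : Set where
  field
    positive : 0 < n
    system   : System
    cover    : IsCover system
    distinct : Unique (moduli system)
    moduli>1 : All (1 <_) (moduli system)
    moduli∣n : All (_∣ n) (moduli system)

ProperDivisor : ℕ → ℕ → Set
ProperDivisor d n = 0 < d × d ∣ n × d < n

PrimitiveCoveringNumber : ℕ → Set
PrimitiveCoveringNumber n =
  CoveringNumber n × (∀ d → ProperDivisor d n → ¬ CoveringNumber d)

-- A duplicate-free list of length r that enumerates the prime divisors of n.
HasExactlyPrimeDivisors : ℕ → ℕ → Set
HasExactlyPrimeDivisors r n =
  ∃[ ps ] Unique ps × length ps ≡ r × (∀ p → p ∈ ps ⇔ (Prime p × p ∣ n))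

-- A set of naturals is infinite when it is unbounded.  This constructive form
-- implies Data.Nat.InfinitelyOften.Inf, which only refutes a bound.
InfinitelyMany : (ℕ → Set) → Set
InfinitelyMany P = ∀ N → ∃[ n ] N < n × P n

{-# OPTIONS --safe #-}

-- Fix primes 2 = p₁ < … < pᵣ and n = p₁^α₁ ⋯ pᵣ^αᵣ, and let τₛ be the number of divisors of
-- p₁^α₁ ⋯ pₛ^αₛ.
--
-- If p ∤ m, a number pᵃm has only as many divisors pᵃe, e ∣ m, as m has divisors. With at
-- least p − 1 of them, the class 0 mod pᵃ⁻¹m can be covered up to the class 0 mod pᵃm, and
-- with p of them completely; with fewer than p they are of no use in a cover. Hence n is a
-- covering number as soon as τₛ ≥ pₛ₊₁ − 1 for s < r − 1 and τᵣ₋₁ ≥ pᵣ, and n is not a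
-- covering number when τₛ < pₛ₊₁ for all s < r.
--
-- Choose pₛ₊₁ ≡ 1 mod τₛ₋₁ = pₛ − 1, and αₛ so that τₛ = pₛ₊₁ − 1 for s < r − 1, while
-- αᵣ₋₁ is one larger than this would require and αᵣ = 1. Then n is a covering number, but
-- if pᵣ is large, then lowering one of α₁, …, αᵣ₋₁ restores τₛ < pₛ₊₁ for all s < r, which also
-- holds for n/pᵣ with its r − 1 primes. The primes ≡ 1 mod m needed here are prime factors
-- of mᴹ − 1 with M = mᵐ.

module Submission where

open import Defs
import Algebra.Definitions.RawSemiring as RawSemiring
import Algebra.Properties.CommutativeSemiring.Binomial as Binomial
open import Data.Empty using (⊥)
open import Data.Fin.Base as Fin using (Fin; toℕ; inject₁; fromℕ)
open import Data.Fin.Properties using (toℕ<n; toℕ-inject₁; toℕ-fromℕ; pigeonhole)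
import Data.Integer as ℤ
open import Data.Integer using (ℤ; +_)
import Data.Integer.DivMod as ℤ
import Data.Integer.Divisibility.Signed as ℤᵈ
import Data.Integer.Properties as ℤ
open import Data.Integer.Tactic.RingSolver using () renaming (solve-∀ to ℤ-solve-∀)
open import Data.List.Base using (List; []; _∷_; map; filter; length; applyUpTo; _++_; lookup)
open import Data.List.Membership.Propositional using (_∈_; find; lose)
open import Data.List.Membership.Propositional.Properties
open import Data.List.Properties using (length-map; length-filter; length-applyUpTo; length-++; map-++)
open import Data.List.Relation.Unary.All as All using (All; []; _∷_)
open import Data.List.Relation.Unary.All.Properties as All using (map⁺)
open import Data.List.Relation.Unary.AllPairs as AllPairs using ([]; _∷_)
import Data.List.Relation.Unary.AllPairs.Properties as AllPairs
open import Data.List.Relation.Unary.Any as Any using (Any; here; there)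
open import Data.List.Relation.Unary.Any.Properties as Any using (++⁺ˡ; ++⁺ʳ; lookup-index)
open import Data.List.Relation.Unary.Unique.Propositional using (Unique)
import Data.List.Relation.Unary.Unique.Propositional.Properties as Unique
open import Data.Nat
open import Data.Nat.Combinatorics using (_C_; nCn≡1; k![n∸k]!∣n!)
open import Data.Nat.Combinatorics.Specification using (nCk≡n!/k![n-k]!)
open import Data.Nat.Coprimality using (coprime-/gcd; coprime-divisor)
open import Data.Nat.DivMod using (m/n*n≡m; m*[n/m]≡n; m/n*n≤m; m*n/n≡m; /-monoˡ-≤; m≥n⇒m/n>0)
open import Data.Nat.Divisibility
open import Data.Nat.GCD
open import Data.Nat.ListAction using (product)
open import Data.Nat.Primality
open import Data.Nat.Primality.Factorisation using (factorise)
open import Data.Nat.Properties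
open import Data.Nat.Tactic.RingSolver using (solve-∀)
open import Data.Product using (_×_; _,_; ∃-syntax; proj₂; ∃₂)
open import Data.Sum using (_⊎_; inj₁; inj₂; [_,_]′)
open import Data.Unit using (⊤; tt)
open import Data.Vec.Base using (Vec; []; _∷_; toList)
open import Data.Vec.Properties using (length-toList)
open import Data.Vec.Relation.Binary.Pointwise.Inductive using (Pointwise; []; _∷_)
open import Function using (_∘_; id; mk⇔)
open import Relation.Binary.PropositionalEquality
open import Relation.Nullary using (¬_; yes; no; contradiction; Dec)
open import Relation.Nullary.Decidable using (map′)

open Binomial +-*-commutativeSemiring using (binomialTerm) renaming (theorem to binomialTheorem)
open RawSemiring +-*-rawSemiring using (sum) renaming (_×_ to _·_; _^_ to _^ˢ_)

-- Primes congruent to 1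

prime⇒>1 : ∀ {p} → Prime p → 1 < p
prime⇒>1 pp = nonTrivial⇒n>1 _ {{prime⇒nonTrivial pp}}

prime∤1 : ∀ {p} → Prime p → ¬ p ∣ 1
prime∤1 pp p∣1 = <⇒≢ (prime⇒>1 pp) (sym (∣1⇒≡1 p∣1))

prime∣^⇒∣ : ∀ {p x} → Prime p → ∀ n → p ∣ x ^ n → p ∣ x
prime∣^⇒∣ pp zero p∣1 = contradiction p∣1 (prime∤1 pp)
prime∣^⇒∣ pp (suc n) p∣ with euclidsLemma _ _ pp p∣
... | inj₁ p∣x = p∣x
... | inj₂ p∣xⁿ = prime∣^⇒∣ pp n p∣xⁿ

prime∣!⇒≤ : ∀ {p} → Prime p → ∀ n → p ∣ n ! → p ≤ n
prime∣!⇒≤ pp zero p∣1 = contradiction p∣1 (prime∤1 pp)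
prime∣!⇒≤ pp (suc n) p∣ with euclidsLemma (suc n) _ pp p∣
... | inj₁ p∣sn = ∣⇒≤ p∣sn
... | inj₂ p∣n! = m≤n⇒m≤1+n (prime∣!⇒≤ pp n p∣n!)

-- `p` divides `p !`, the product of the binomial coefficient with `k !` and `(p ∸ k) !`, which have
-- only factors below `p`.
prime∣binomial : ∀ {p k} → Prime p → 0 < k → k < p → p ∣ p C k
prime∣binomial {p@(suc q)} {k@(suc l)} pp 0<k k<p
  with euclidsLemma (p C k) (k ! * (p ∸ k) !) pp
         (subst (p ∣_) (sym C*k![p-k]!≡p!) (m∣m*n (q !)))
  where
  instance _ = k !* (p ∸ k) !≢0
  C*k![p-k]!≡p! : (p C k) * (k ! * (p ∸ k) !) ≡ p !
  C*k![p-k]!≡p! = trans (cong (_* (k ! * (p ∸ k) !)) (nCk≡n!/k![n-k]! (<⇒≤ k<p)))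
                        (m/n*n≡m (k![n∸k]!∣n! (<⇒≤ k<p)))
... | inj₁ p∣C = p∣C
... | inj₂ p∣k![p-k]! with euclidsLemma (k !) _ pp p∣k![p-k]!
...   | inj₁ p∣k! = contradiction (prime∣!⇒≤ pp k p∣k!) (<⇒≱ k<p)
...   | inj₂ p∣[p-k]! = contradiction (prime∣!⇒≤ pp (p ∸ k) p∣[p-k]!)
                          (<⇒≱ (s≤s (m∸n≤m q l)))

·≡* : ∀ n x → n · x ≡ n * x
·≡* zero    x = refl
·≡* (suc n) x = cong (λ y → x + y) (·≡* n x)

^ˢ≡^ : ∀ x n → x ^ˢ n ≡ x ^ n
^ˢ≡^ x zero    = refl
^ˢ≡^ x (suc n) = cong (x *_) (^ˢ≡^ x n)

-- Meant for the binomial expansion without its first term, where every term but the last is a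
-- multiple of the prime.
sum≡last[mod] : ∀ {d} n (t : Fin (suc n) → ℕ) → (∀ i → d ∣ t (inject₁ i)) →
                ∃[ k ] sum t ≡ t (fromℕ n) + d * k
sum≡last[mod] {d} zero t _ = 0 , cong (λ y → t Fin.zero + y) (sym (*-zeroʳ d))
sum≡last[mod] {d} (suc n) t d∣t
  with k , eq ← sum≡last[mod] n (t ∘ Fin.suc) (d∣t ∘ Fin.suc)
     | divides c t₀≡c*d ← d∣t Fin.zero = c + k , (begin
  t Fin.zero + sum (t ∘ Fin.suc)            ≡⟨ cong₂ _+_ t₀≡c*d eq ⟩
  c * d + (t (Fin.suc (fromℕ n)) + d * k)   ≡⟨ rearrange c d _ k ⟩
  t (Fin.suc (fromℕ n)) + d * (c + k)       ∎)
  where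
  open ≡-Reasoning
  rearrange : ∀ c d l k → c * d + (l + d * k) ≡ l + d * (c + k)
  rearrange = solve-∀

freshman : ∀ {p} → Prime p → ∀ x → ∃[ k ] (x + 1) ^ p ≡ x ^ p + 1 + p * k
freshman {p@(suc q)} pp x
  = let k , eq = sum≡last[mod] q (binomialTerm x 1 p ∘ Fin.suc) mid in k , (begin
  (x + 1) ^ p        ≡⟨ ^ˢ≡^ (x + 1) p ⟨
  (x + 1) ^ˢ p       ≡⟨ binomialTheorem p x 1 ⟩
  binomialTerm x 1 p Fin.zero + sum (binomialTerm x 1 p ∘ Fin.suc)
    ≡⟨ cong₂ _+_ first eq ⟩
  1 + (binomialTerm x 1 p (fromℕ p) + p * k)
    ≡⟨ cong (λ z → 1 + (z + p * k)) final ⟩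
  1 + (x ^ p + p * k) ≡⟨ rearrange (x ^ p) (p * k) ⟩
  x ^ p + 1 + p * k   ∎)
  where
  open ≡-Reasoning
  rearrange : ∀ a b → 1 + (a + b) ≡ a + 1 + b
  rearrange = solve-∀
  first : binomialTerm x 1 p Fin.zero ≡ 1
  first = trans (·≡* 1 _) (trans (*-identityˡ _)
            (trans (*-identityˡ _) (trans (^ˢ≡^ 1 p) (^-zeroˡ p))))
  final : binomialTerm x 1 p (fromℕ p) ≡ x ^ p
  final rewrite toℕ-fromℕ q | nCn≡1 p | n∸n≡0 q =
    trans (+-identityʳ _) (trans (*-identityʳ _) (^ˢ≡^ x p))
  mid : ∀ i → p ∣ binomialTerm x 1 p (Fin.suc (inject₁ i))
  mid i = subst (p ∣_) (sym (·≡* (p C suc (toℕ (inject₁ i))) _))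
    (∣m⇒∣m*n _ (prime∣binomial {p} {suc (toℕ (inject₁ i))} pp z<s
      (s<s (subst (_< q) (sym (toℕ-inject₁ i)) (toℕ<n i)))))

x^p≡x[mod] : ∀ {p} → Prime p → ∀ x → ∃[ k ] x ^ p ≡ x + p * k
x^p≡x[mod] {p@(suc _)} pp zero = 0 , sym (*-zeroʳ p)
x^p≡x[mod] {p} pp (suc x)
  with k , eq ← freshman pp x | l , eq′ ← x^p≡x[mod] pp x = l + k , (begin
  suc x ^ p             ≡⟨ cong (_^ p) (+-comm 1 x) ⟩
  (x + 1) ^ p           ≡⟨ eq ⟩
  x ^ p + 1 + p * k     ≡⟨ cong (λ z → z + 1 + p * k) eq′ ⟩
  x + p * l + 1 + p * k ≡⟨ rearrange x p l k ⟩
  suc x + p * (l + k)   ∎)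
  where
  open ≡-Reasoning
  rearrange : ∀ x p l k → x + p * l + 1 + p * k ≡ suc x + p * (l + k)
  rearrange = solve-∀

-- Exponents whose power is congruent to 1

infix 4 _≡1[mod_]

-- The natural quotient avoids subtraction and forces `x` to be positive.
record _≡1[mod_] (x p : ℕ) : Set where
  constructor mod1
  field
    quotient : ℕ
    equality : x ≡ suc (p * quotient)

-- `p` divides xᵖ - x = x(xᵖ⁻¹ - 1) but not `x`.
fermat : ∀ {p x} → Prime p → ¬ p ∣ x → x ^ pred p ≡1[mod p ]
fermat {p@(suc q)} {zero} pp p∤x = contradiction (p ∣0) p∤x
fermat {p@(suc q)} {x@(suc _)} pp p∤x = conclude (euclidsLemma x w pp (p∣xw (x^p≡x[mod] pp x)))
  where
  w = pred (x ^ q)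
  1+w≡x^q : suc w ≡ x ^ q
  1+w≡x^q = suc-pred (x ^ q) {{m^n≢0 x q}}
  p∣xw : ∃[ k ] x ^ p ≡ x + p * k → p ∣ x * w
  p∣xw (k , eq) = divides k (trans (+-cancelˡ-≡ x (x * w) (p * k)
    (trans (sym (*-suc x w)) (trans (cong (x *_) 1+w≡x^q) eq))) (*-comm p k))
  conclude : p ∣ x ⊎ p ∣ w → x ^ q ≡1[mod p ]
  conclude (inj₁ p∣x) = contradiction p∣x p∤x
  conclude (inj₂ (divides c w≡c*p)) = mod1 c (trans (sym 1+w≡x^q) (cong suc (trans w≡c*p (*-comm c p))))

≡1-^ : ∀ {p x} n → x ≡1[mod p ] → x ^ n ≡1[mod p ]
≡1-^ {p} zero _ = mod1 0 (cong suc (sym (*-zeroʳ p)))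
≡1-^ {p} {x} (suc n) x≡1@(mod1 k eq) with mod1 l eq′ ← ≡1-^ n x≡1 =
  mod1 _ (trans (cong₂ _*_ eq eq′) (rearrange p k l))
  where
  rearrange : ∀ p k l → suc (p * k) * suc (p * l) ≡ suc (p * (k + l + k * (p * l)))
  rearrange = solve-∀

≡1-cancelʳ : ∀ {p} x y → y ≡1[mod p ] → x * y ≡1[mod p ] → x ≡1[mod p ]
≡1-cancelʳ zero y _ (mod1 _ ())
≡1-cancelʳ {p} (suc x) y (mod1 k refl) (mod1 l eq) with ∣m+n∣m⇒∣n p∣ (m∣m*n (suc x * k))
  where
  rearrange : ∀ x p k → p * (suc x * k) + x ≡ p * k + x * suc (p * k)
  rearrange = solve-∀
  p∣ : p ∣ p * (suc x * k) + x
  p∣ = divides l (trans (rearrange x p k) (trans (suc-injective eq) (*-comm p l)))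
... | divides c x≡c*p = mod1 c (cong suc (trans x≡c*p (*-comm c p)))

≡1-∣ : ∀ {p x m n} → m ∣ n → x ^ m ≡1[mod p ] → x ^ n ≡1[mod p ]
≡1-∣ {p} {x} {m} (divides q refl) h =
  subst (_≡1[mod p ]) (trans (^-*-assoc x m q) (cong (x ^_) (*-comm m q))) (≡1-^ q h)

≡1-∸ : ∀ {p x} a b {c} → a + b ≡ c → x ^ b ≡1[mod p ] → x ^ c ≡1[mod p ] → x ^ a ≡1[mod p ]
≡1-∸ {p} {x} a b refl xᵇ xᶜ = ≡1-cancelʳ (x ^ a) (x ^ b) xᵇ
  (subst (_≡1[mod p ]) (^-distribˡ-+-* x a b) xᶜ)

-- Bézout over ℕ: the gcd is the difference of a multiple of `m` and a multiple of `n`, in one order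
-- or the other.
≡1-gcd : ∀ {p x} m n → x ^ m ≡1[mod p ] → x ^ n ≡1[mod p ] → x ^ gcd m n ≡1[mod p ]
≡1-gcd {x = x} m n xᵐ xⁿ with Bézout.identity (gcd-GCD m n)
... | Bézout.Identity.+- a b eq =
  ≡1-∸ {x = x} (gcd m n) (b * n) eq (≡1-∣ {x = x} (n∣m*n b) xⁿ) (≡1-∣ {x = x} (n∣m*n a) xᵐ)
... | Bézout.Identity.-+ a b eq =
  ≡1-∸ {x = x} (gcd m n) (a * m) eq (≡1-∣ {x = x} (n∣m*n a) xᵐ) (≡1-∣ {x = x} (n∣m*n b) xⁿ)

-- Divisors of products and powers

^-monoˡ-∣ : ∀ {m n} k → m ∣ n → m ^ k ∣ n ^ k
^-monoˡ-∣ zero    _   = ∣-refl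
^-monoˡ-∣ (suc k) m∣n = *-pres-∣ m∣n (^-monoˡ-∣ k m∣n)

^-monoʳ-∣ : ∀ x {m n} → m ≤ n → x ^ m ∣ x ^ n
^-monoʳ-∣ x {m} {n} m≤n = subst (x ^ m ∣_) (trans (sym (^-distribˡ-+-* x m (n ∸ m)))
  (cong (x ^_) (m+[n∸m]≡n m≤n))) (m∣m*n _)

^-distribʳ-* : ∀ m n k → (m * n) ^ k ≡ m ^ k * n ^ k
^-distribʳ-* m n zero    = refl
^-distribʳ-* m n (suc k) = trans (cong (m * n *_) (^-distribʳ-* m n k)) (rearrange m n (m ^ k) (n ^ k))
  where
  rearrange : ∀ m n a b → m * n * (a * b) ≡ m * a * (n * b)
  rearrange = solve-∀

-- The product is the gcd of `gcd d x * d` and `gcd d x * y`, and the latter is the gcd of `y * d`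
-- and `y * x`, both multiples of `d`.
∣*⇒∣gcd*gcd : ∀ d x y → d ∣ x * y → d ∣ gcd d x * gcd d y
∣*⇒∣gcd*gcd d x y d∣xy = subst (d ∣_) (sym (c*gcd[m,n]≡gcd[cm,cn] (gcd d x) d y))
  (gcd-greatest (n∣m*n (gcd d x))
    (subst (d ∣_) (trans (sym (c*gcd[m,n]≡gcd[cm,cn] y d x)) (*-comm y _))
      (gcd-greatest (n∣m*n y) (subst (d ∣_) (*-comm x y) d∣xy))))

-- Splits off one factor `m` and recurses with `gcd d (m ^ k)` in place of `d`.
∣^⇒∣gcd^ : ∀ m k d → d ∣ m ^ k → d ∣ gcd d m ^ k
∣^⇒∣gcd^ m zero    d d∣1 = d∣1
∣^⇒∣gcd^ m (suc k) d d∣  = ∣-trans (∣*⇒∣gcd*gcd d m (m ^ k) d∣)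
  (*-monoʳ-∣ (gcd d m) (∣-trans (∣^⇒∣gcd^ m k e (gcd[m,n]∣n d _))
    (^-monoˡ-∣ k (gcd-greatest (∣-trans (gcd[m,n]∣m e m) (gcd[m,n]∣m d _)) (gcd[m,n]∣n e m)))))
  where e = gcd d (m ^ k)

-- Unitary divisors and geometric sums

Unitary : ℕ → ℕ → Set
Unitary X N = ∃[ Y ] X * Y ≡ N × (∀ {p} → Prime p → p ∣ X → ¬ p ∣ Y)

primeDivisor : ∀ {n} → 1 < n → ∃[ p ] Prime p × p ∣ n
primeDivisor {n@(suc _)} 1<n with factorise n
... | record { factors = [] ; isFactorisation = n≡1 } = contradiction (sym n≡1) (<⇒≢ 1<n)
... | record { factors = p ∷ ps ; isFactorisation = eq ; factorsPrime = pp ∷ _ } =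
  p , pp , divides (product ps) (trans eq (*-comm p _))

-- Dividing Q by gcd(Q, X) leaves a number coprime to X, because X is a unitary divisor.
primeOutside : ∀ {N} Xs {Q} → 0 < N → All (λ X → Unitary X N) Xs → Q ∣ N → product Xs < Q →
               ∃[ p ] Prime p × p ∣ Q × All (λ X → ¬ p ∣ X) Xs
primeOutside [] _ [] _ 1<Q with p , pp , p∣Q ← primeDivisor 1<Q = p , pp , p∣Q , []
primeOutside (zero ∷ Xs) () ((Y , refl , _) ∷ _) _ _
primeOutside {N} (X@(suc _) ∷ Xs) {Q@(suc _)} 0<N ((Y , XY≡N , cop) ∷ us) Q∣N ΠXs<Q
  = let p , pp , p∣R , p∤Xs = primeOutside Xs 0<N us (∣-trans R∣Q Q∣N) ΠXs<R in
  p , pp , ∣-trans p∣R R∣Q ,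
  (λ p∣X → cop pp p∣X (∣-trans p∣R R∣Y)) ∷ p∤Xs
  where
  g = gcd Q X
  instance _ = ≢-nonZero (gcd[m,n]≢0 Q X (inj₁ λ ()))
  R = Q / g
  Q≡gR : g * R ≡ Q
  Q≡gR = m*[n/m]≡n (gcd[m,n]∣m Q X)
  R∣Q : R ∣ Q
  R∣Q = divides g (sym Q≡gR)
  ΠXs<R : product Xs < R
  -- The removed factor `g` is at most `X`.
  ΠXs<R = *-cancelˡ-< X _ _ (<-≤-trans ΠXs<Q (≤-trans (≤-reflexive (sym Q≡gR))
            (*-monoˡ-≤ R (∣⇒≤ (gcd[m,n]∣n Q X)))))
  R∣Y : R ∣ Y
  -- `g * R` divides N = g(X/g)Y, and `R` is coprime to X/g.
  R∣Y = coprime-divisor (coprime-/gcd Q X) (*-cancelˡ-∣ g (subst₂ _∣_ (sym Q≡gR)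
          (trans (sym XY≡N) (trans (cong (_* Y) (sym (m*[n/m]≡n (gcd[m,n]∣n Q X)))) (*-assoc g _ Y))) Q∣N))

-- The sum of (1 + y)ⁱ over i < k, that is, ((1 + y)ᵏ - 1)/y for y > 0.
geometric : ℕ → ℕ → ℕ
geometric y zero    = 0
geometric y (suc k) = 1 + suc y * geometric y k

geometric-sum : ∀ y k → suc (y * geometric y k) ≡ suc y ^ k
geometric-sum y zero    = cong suc (*-zeroʳ y)
geometric-sum y (suc k) = trans (rearrange y (geometric y k)) (cong (suc y *_) (geometric-sum y k))
  where
  rearrange : ∀ y s → suc (y * (1 + suc y * s)) ≡ suc y * suc (y * s)
  rearrange = solve-∀

-- Each of the `k` summands is 1 mod `y`. Hence a common prime factor of `y` and the sum divides
-- `k`.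
geometric-mod : ∀ y k → ∃[ t ] geometric y k ≡ y * t + k
geometric-mod y zero = 0 , sym (trans (+-identityʳ _) (*-zeroʳ y))
geometric-mod y (suc k) with t , eq ← geometric-mod y k =
  _ , trans (cong (λ s → 1 + suc y * s) eq) (rearrange y t k)
  where
  rearrange : ∀ y t k → 1 + suc y * (y * t + k) ≡ y * (t + (y * t + k)) + suc k
  rearrange = solve-∀

product≤ : ∀ b Xs → All (_≤ b) Xs → product Xs ≤ b ^ length Xs
product≤ b []       []         = ≤-refl
product≤ b (X ∷ Xs) (X≤b ∷ ≤b) = *-mono-≤ X≤b (product≤ b Xs ≤b)

n<2^n : ∀ n → n < 2 ^ n
n<2^n zero    = z<s
n<2^n (suc n) = ≤-trans (s≤s (n<2^n n)) (≤-trans (+-monoˡ-≤ (2 ^ n) (m^n>0 2 n))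
  (+-monoʳ-≤ (2 ^ n) (≤-reflexive (sym (+-identityʳ _)))))

-- Let M = mᵐ and let p be a prime factor of mᴹ − 1 dividing no m^(gᵐ) − 1 with g a proper
-- divisor of m; it exists because the latter numbers are unitary divisors of mᴹ − 1 whose
-- product is smaller. Then m has order dividing d = gcd(M , p − 1) modulo p, and
-- d ∣ gcd(d , m)ᵐ forces gcd(d , m) = m.
module _ (m : ℕ) (1<m : 1 < m) where
  private
    instance _ = >-nonZero (<-trans z<s 1<m)
    M = m ^ m
    -- An upper bound for the proper divisors g of `m`, so that `m ^ e` bounds every `X g`.
    h = m / 2
    e = h ^ m
    N = pred (m ^ M)

    X : ℕ → ℕ
    X g = pred (m ^ (g ^ m))

    gs : List ℕ
    gs = filter (_∣? m) (applyUpTo suc (pred m))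

    sucN : suc N ≡ m ^ M
    sucN = suc-pred (m ^ M) {{m^n≢0 m M}}

    sucX : ∀ g → suc (X g) ≡ m ^ (g ^ m)
    sucX g = suc-pred (m ^ (g ^ m)) {{m^n≢0 m (g ^ m)}}

    ∈gs⁻ : ∀ {g} → g ∈ gs → 0 < g × g < m × g ∣ m
    ∈gs⁻ g∈gs with g∈ , g∣m ← ∈-filter⁻ (_∣? m) {xs = applyUpTo suc (pred m)} g∈gs
              with i , i<m-1 , refl ← ∈-applyUpTo⁻ suc g∈ =
      z<s , ≤-trans (s≤s i<m-1) (≤-reflexive (suc-pred m)) , g∣m

    ∈gs⁺ : ∀ {g} → g < m → g ∣ m → g ∈ gs
    ∈gs⁺ {zero} _ 0∣m = contradiction (sym (0∣⇒≡0 0∣m)) (<⇒≢ (<-trans z<s 1<m))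
    ∈gs⁺ {suc g} g<m g∣m = ∈-filter⁺ (_∣? m) (∈-applyUpTo⁺ suc (pred-mono-≤ g<m)) g∣m

    2h≤m : 2 * h ≤ m
    2h≤m = ≤-trans (≤-reflexive (*-comm 2 h)) (m/n*n≤m m 2)

    g≤h : ∀ {g} → g < m → g ∣ m → g ≤ h
    g≤h g<m (divides 0 m≡0) = contradiction (sym m≡0) (<⇒≢ (<-trans z<s 1<m))
    g≤h {g} g<m (divides 1 m≡) = contradiction (sym (trans m≡ (+-identityʳ g))) (<⇒≢ g<m)
    g≤h {g} g<m (divides (suc (suc q)) m≡) = subst (_≤ h) (m*n/n≡m g 2) (/-monoˡ-≤ 2
      (≤-trans (≤-reflexive (*-comm g 2)) (≤-trans (*-monoˡ-≤ g {2} {suc (suc q)} (s≤s (s≤s z≤n))) (≤-reflexive (sym m≡)))))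

    p∣mᴹ-1⇒p∤m : ∀ {p} → Prime p → p ∣ N → ¬ p ∣ m
    p∣mᴹ-1⇒p∤m {p} pp p∣N p∣m = prime∤1 pp (∣m+n∣m⇒∣n (subst (p ∣_) (+-comm 1 N)
      (subst (p ∣_) (sym sucN) (∣-trans p∣m (subst (λ k → m ∣ m ^ k) (suc-pred M {{m^n≢0 m m}}) (m∣m*n _))))) p∣N)

    unitary : ∀ {g} → g ∈ gs → Unitary (X g) N
    unitary {g} g∈gs with 0<g , g<m , divides j m≡jg ← ∈gs⁻ g∈gs =
      geometric (X g) k , XY≡N , coprime
      where
      k = j ^ m
      gᵐk≡M : g ^ m * k ≡ M
      gᵐk≡M = trans (sym (^-distribʳ-* g j m)) (cong (_^ m) (trans (*-comm g j) (sym m≡jg)))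
      XY≡N : X g * geometric (X g) k ≡ N
      XY≡N = suc-injective (trans (geometric-sum (X g) k) (trans (cong (_^ k) (sucX g))
        (trans (^-*-assoc m (g ^ m) k) (trans (cong (m ^_) gᵐk≡M) (sym sucN)))))
      coprime : ∀ {p} → Prime p → p ∣ X g → ¬ p ∣ geometric (X g) k
      coprime {p} pp p∣X p∣Y with t , eq ← geometric-mod (X g) k =
        p∣mᴹ-1⇒p∤m pp (subst (p ∣_) XY≡N (∣m⇒∣m*n _ p∣X)) (prime∣^⇒∣ pp m (∣-trans
          (∣m+n∣m⇒∣n (subst (p ∣_) eq p∣Y) (∣m⇒∣m*n t p∣X)) (divides (g ^ m) (sym gᵐk≡M))))

    0<h : 0 < h
    0<h = m≥n⇒m/n>0 1<m

    -- em < e2ᵐ = (2h)ᵐ ≤ mᵐ.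
    em<M : e * m < M
    em<M = <-≤-trans (*-monoʳ-< e {{m^n≢0 h m {{>-nonZero 0<h}}}} (n<2^n m)) (≤-trans
      (≤-reflexive (trans (*-comm e (2 ^ m)) (sym (^-distribʳ-* 2 h m)))) (^-monoˡ-≤ m 2h≤m))

    -- There are at most `m` factors, each at most `m ^ e`, and `em<M` leaves room for one more
    -- factor `m`.
    ΠX<N : product (map X gs) < N
    ΠX<N = s≤s⁻¹ (begin-strict
      suc (product (map X gs))            ≤⟨ s≤s (product≤ (m ^ e) (map X gs) (All.map⁺ (All.tabulate X≤))) ⟩
      suc ((m ^ e) ^ length (map X gs))   ≤⟨ s≤s (^-monoʳ-≤ (m ^ e) {{m^n≢0 m e}} length≤) ⟩
      suc ((m ^ e) ^ m)                   ≡⟨ cong suc (^-*-assoc m e m) ⟩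
      suc P                               <⟨ +-monoˡ-< P 1<P ⟩
      P + P                               ≡⟨ cong (λ y → P + y) (+-identityʳ P) ⟨
      2 * P                               ≤⟨ *-monoˡ-≤ P 1<m ⟩
      m ^ suc (e * m)                     ≤⟨ ^-monoʳ-≤ m em<M ⟩
      m ^ M                               ≡⟨ sucN ⟨
      suc N                               ∎)
      where
      open ≤-Reasoning
      P = m ^ (e * m)
      1<P : 1 < P
      1<P = <-≤-trans 1<m (≤-trans (≤-reflexive (sym (*-identityʳ m)))
        (^-monoʳ-≤ m (*-mono-≤ (m^n>0 h {{>-nonZero 0<h}} m) (<⇒≤ 1<m))))
      X≤ : ∀ {g} → g ∈ gs → X g ≤ m ^ e
      X≤ {g} g∈gs with _ , g<m , g∣m ← ∈gs⁻ g∈gs =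
        ≤-trans pred[n]≤n (^-monoʳ-≤ m (^-monoˡ-≤ m (g≤h g<m g∣m)))
      length≤ : length (map X gs) ≤ m
      length≤ = ≤-trans (≤-reflexive (length-map X gs)) (≤-trans (length-filter (_∣? m) (applyUpTo suc (pred m)))
        (≤-trans (≤-reflexive (length-applyUpTo suc (pred m))) pred[n]≤n))

  prime≡1[mod] : ∃[ p ] Prime p × m ∣ pred p
  prime≡1[mod]
    with p , pp , p∣N@(divides c N≡cp) , p∤Xs ← primeOutside (map X gs) (≤-<-trans z≤n ΠX<N)
           (All.map⁺ (All.tabulate unitary)) ∣-refl ΠX<N
    with gcd (gcd M (pred p)) m ≟ m
  ... | yes g≡m = p , pp , ∣-trans (subst (_∣ gcd M (pred p)) g≡m (gcd[m,n]∣m _ m)) (gcd[m,n]∣n M _)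
  ... | no  g≢m = contradiction p∣Xg (All.lookup p∤Xs (∈-map⁺ X (∈gs⁺ (≤∧≢⇒< (∣⇒≤ (gcd[m,n]∣n d m)) g≢m) (gcd[m,n]∣n d m))))
    where
    d = gcd M (pred p)
    g = gcd d m
    mᵈ≡1 : m ^ d ≡1[mod p ]
    mᵈ≡1 = ≡1-gcd M (pred p) (mod1 c (trans (sym sucN) (cong suc (trans N≡cp (*-comm c p)))))
             (fermat pp (p∣mᴹ-1⇒p∤m pp p∣N))
    p∣Xg : p ∣ X g
    -- `d` divides `M`, a power of `m`, hence it divides `g ^ m`.
    p∣Xg with mod1 l eq ← ≡1-∣ {x = m} (∣^⇒∣gcd^ m m d (gcd[m,n]∣m M _)) mᵈ≡1 =
      divides l (trans (suc-injective (trans (sucX g) eq)) (*-comm p l))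

-- Covers

-- With `gcd d x` as the first factor, the quotient divides `gcd d y` by `∣*⇒∣gcd*gcd`.
∣*-split : ∀ {d} x {y} → .{{NonZero x}} → d ∣ x * y → ∃₂ λ e f → e ∣ x × f ∣ y × d ≡ e * f
∣*-split {d} x {y} d∣xy with gcd[m,n]∣m d x
... | divides f d≡fg = g , f , gcd[m,n]∣n d x , ∣-trans f∣gcd (gcd[m,n]∣n d y) , trans d≡fg (*-comm f g)
  where
  g = gcd d x
  instance _ = ≢-nonZero (gcd[m,n]≢0 d x (inj₂ (≢-nonZero⁻¹ x)))
  f∣gcd : f ∣ gcd d y
  f∣gcd = *-cancelˡ-∣ g (subst (_∣ g * gcd d y) (trans d≡fg (*-comm f g)) (∣*⇒∣gcd*gcd d x y d∣xy))

∣prime^ : ∀ {p d} → Prime p → ∀ a → d ∣ p ^ a → ∃[ b ] b ≤ a × d ≡ p ^ b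
∣prime^ pp zero d∣1 = 0 , z≤n , ∣1⇒≡1 d∣1
∣prime^ {p} pp (suc a) d∣ with e , f , e∣p , f∣pᵃ , refl ← ∣*-split p {{prime⇒nonZero pp}} d∣
  with b , b≤a , refl ← ∣prime^ pp a f∣pᵃ | prime⇒irreducible pp e∣p
... | inj₁ refl = b , m≤n⇒m≤1+n b≤a , +-identityʳ _
... | inj₂ refl = suc b , s≤s b≤a , refl

∣prime^*-split : ∀ {p d m} → Prime p → ∀ a → d ∣ p ^ a * m → ∃₂ λ b e → b ≤ a × e ∣ m × d ≡ p ^ b * e
∣prime^*-split {p} pp a d∣ with f , e , f∣pᵃ , e∣m , refl ← ∣*-split (p ^ a) {{m^n≢0 p a {{prime⇒nonZero pp}}}} d∣
  with b , b≤a , refl ← ∣prime^ pp a f∣pᵃ = b , e , b≤a , e∣m , refl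

-- Lists of divisors

record IsDivisorList (m : ℕ) (ds : List ℕ) : Set where
  field
    unique   : Unique ds
    sound    : ∀ {d} → d ∈ ds → d ∣ m
    complete : ∀ {d} → d ∣ m → d ∈ ds

open IsDivisorList

withPowers : ℕ → ℕ → List ℕ → List ℕ
withPowers p zero    ds = ds
withPowers p (suc a) ds = map (p ^ suc a *_) ds ++ withPowers p a ds

length-withPowers : ∀ p a ds → length (withPowers p a ds) ≡ suc a * length ds
length-withPowers p zero    ds = sym (+-identityʳ _)
length-withPowers p (suc a) ds = trans (length-++ (map (p ^ suc a *_) ds))
  (cong₂ _+_ (length-map _ ds) (length-withPowers p a ds))

∈-withPowers : ∀ {p e ds} → e ∈ ds → ∀ {b a} → b ≤ a → p ^ b * e ∈ withPowers p a ds
∈-withPowers {p} {e} e∈ {a = zero}  z≤n = subst (_∈ _) (sym (*-identityˡ e)) e∈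
∈-withPowers {p} {e} {ds} e∈ {b} {suc a} b≤1+a with m≤n⇒m<n∨m≡n b≤1+a
... | inj₁ b<1+a = ++⁺ʳ (map (p ^ suc a *_) ds) (∈-withPowers e∈ (≤-pred b<1+a))
... | inj₂ refl  = ++⁺ˡ (∈-map⁺ (p ^ suc a *_) e∈)

-- Cancelling `p ^ a` would leave p ∣ m. This keeps the numbers with a new power of `p` apart from
-- the earlier ones.
p^[1+a]*e∤p^a*m : ∀ {p m} → Prime p → ¬ p ∣ m → ∀ a e → ¬ p ^ suc a * e ∣ p ^ a * m
p^[1+a]*e∤p^a*m {p} {m} pp p∤m a e h = p∤m (m*n∣⇒m∣ p e (*-cancelˡ-∣ (p ^ a) {{m^n≢0 p a {{prime⇒nonZero pp}}}}
  (subst (_∣ p ^ a * m) (rearrange p (p ^ a) e) h)))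
  where
  rearrange : ∀ p x e → p * x * e ≡ x * (p * e)
  rearrange = solve-∀

withPowers-isDivisorList : ∀ {p m ds} → Prime p → ¬ p ∣ m → IsDivisorList m ds →
                           ∀ a → IsDivisorList (p ^ a * m) (withPowers p a ds)
withPowers-isDivisorList {p} {m} {ds} pp p∤m isD a = record
  { unique = uniq a ; sound = snd a ; complete = cmp }
  where
  snd : ∀ a {d} → d ∈ withPowers p a ds → d ∣ p ^ a * m
  snd zero    d∈ = ∣n⇒∣m*n 1 (sound isD d∈)
  snd (suc a) d∈ with ∈-++⁻ (map (p ^ suc a *_) ds) d∈
  ... | inj₂ d∈′ = ∣-trans (snd a d∈′) (*-monoˡ-∣ m (n∣m*n p))
  ... | inj₁ d∈′ with e , e∈ , refl ← ∈-map⁻ (p ^ suc a *_) d∈′ = *-monoʳ-∣ (p ^ suc a) (sound isD e∈)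
  cmp : ∀ {d} → d ∣ p ^ a * m → d ∈ withPowers p a ds
  cmp d∣ with b , e , b≤a , e∣m , refl ← ∣prime^*-split pp a d∣ = ∈-withPowers (complete isD e∣m) b≤a
  uniq : ∀ a → Unique (withPowers p a ds)
  uniq zero    = unique isD
  uniq (suc a) = Unique.++⁺
    (Unique.map⁺ (λ {x} {y} → *-cancelˡ-≡ x y (p ^ suc a) {{m^n≢0 p (suc a) {{prime⇒nonZero pp}}}}) (unique isD))
    (uniq a) disjoint
    where
    disjoint : ∀ {d} → d ∈ map (p ^ suc a *_) ds × d ∈ withPowers p a ds → ⊥
    disjoint (d∈ , d∈′) with e , _ , refl ← ∈-map⁻ (p ^ suc a *_) d∈ = p^[1+a]*e∤p^a*m pp p∤m a e (snd a d∈′)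

-- Residue classes and the descent to a smaller power of p

moduli-injective : ∀ {s c c′} → Unique (moduli s) → c ∈ s → c′ ∈ s → modulus c ≡ modulus c′ → c ≡ c′
moduli-injective (_ ∷ _)  (here refl) (here refl) _ = refl
moduli-injective (c≢ ∷ _) (here refl) (there c′∈) eq = contradiction eq (All.lookup c≢ (∈-map⁺ modulus c′∈))
moduli-injective (c≢ ∷ _) (there c∈) (here refl) eq = contradiction (sym eq) (All.lookup c≢ (∈-map⁺ modulus c∈))
moduli-injective (_ ∷ u)  (there c∈) (there c′∈) eq = moduli-injective u c∈ c′∈ eq

∈ᶜ-shift : ∀ {z c} y → modulus c ∣ y → ∀ x → z ℤ.+ + y ℤ.* x ∈ᶜ c → z ∈ᶜ c
∈ᶜ-shift {z} {c} _ (divides q refl) x (w , eq) = w ℤ.- + q ℤ.* x , (begin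
  z                                                     ≡⟨ lemma₁ z (+ (q * modulus c)) x ⟩
  z ℤ.+ + (q * modulus c) ℤ.* x ℤ.- + (q * modulus c) ℤ.* x
    ≡⟨ cong₂ (λ u v → u ℤ.- v ℤ.* x) eq (ℤ.pos-* q (modulus c)) ⟩
  residue c ℤ.+ + modulus c ℤ.* w ℤ.- + q ℤ.* + modulus c ℤ.* x
    ≡⟨ lemma₂ (residue c) (+ modulus c) w (+ q) x ⟩
  residue c ℤ.+ + modulus c ℤ.* (w ℤ.- + q ℤ.* x)        ∎)
  where
  open ≡-Reasoning
  lemma₁ : ∀ z y x → z ≡ z ℤ.+ y ℤ.* x ℤ.- y ℤ.* x
  lemma₁ = ℤ-solve-∀
  lemma₂ : ∀ r m w q x → r ℤ.+ m ℤ.* w ℤ.- q ℤ.* m ℤ.* x ≡ r ℤ.+ m ℤ.* (w ℤ.- q ℤ.* x)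
  lemma₂ = ℤ-solve-∀

-- Decidability allows the descent to refute a missed integer constructively.
∈ᶜ? : ∀ z c → Dec (z ∈ᶜ c)
∈ᶜ? z c = map′ to from (+ modulus c ℤᵈ.∣? (z ℤ.- residue c))
  where
  lemma₁ : ∀ z r → z ≡ r ℤ.+ (z ℤ.- r)
  lemma₁ = ℤ-solve-∀
  lemma₂ : ∀ r m x → r ℤ.+ m ℤ.* x ℤ.- r ≡ x ℤ.* m
  lemma₂ = ℤ-solve-∀
  to : + modulus c ℤᵈ.∣ z ℤ.- residue c → z ∈ᶜ c
  to (ℤᵈ.divides q eq) = q , trans (lemma₁ z (residue c))
    (cong (λ y → residue c ℤ.+ y) (trans eq (ℤ.*-comm q (+ modulus c))))
  from : z ∈ᶜ c → + modulus c ℤᵈ.∣ z ℤ.- residue c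
  from (x , refl) = ℤᵈ.divides x (lemma₂ (residue c) (+ modulus c) x)

∈ᶜ-difference : ∀ {z c} n {i j} → i ≤ j → z ℤ.+ + n ℤ.* + i ∈ᶜ c → z ℤ.+ + n ℤ.* + j ∈ᶜ c →
                modulus c ∣ n * (j ∸ i)
∈ᶜ-difference {z} {c} n {i} {j} i≤j (x , eq) (y , eq′) =
  ℤᵈ.∣⇒∣ᵤ {+ modulus c} {+ (n * (j ∸ i))} (ℤᵈ.divides (y ℤ.- x) (begin
    + (n * (j ∸ i))                        ≡⟨ ℤ.pos-* n (j ∸ i) ⟩
    + n ℤ.* + (j ∸ i)                      ≡⟨ lemma₁ z (+ n) (+ i) (+ (j ∸ i)) ⟩
    z ℤ.+ + n ℤ.* (+ i ℤ.+ + (j ∸ i)) ℤ.- (z ℤ.+ + n ℤ.* + i)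
      ≡⟨ cong (λ k → z ℤ.+ + n ℤ.* k ℤ.- (z ℤ.+ + n ℤ.* + i)) (trans (sym (ℤ.pos-+ i (j ∸ i))) (cong +_ (m+[n∸m]≡n i≤j))) ⟩
    z ℤ.+ + n ℤ.* + j ℤ.- (z ℤ.+ + n ℤ.* + i)
      ≡⟨ cong₂ ℤ._-_ eq′ eq ⟩
    residue c ℤ.+ + modulus c ℤ.* y ℤ.- (residue c ℤ.+ + modulus c ℤ.* x)
      ≡⟨ lemma₂ (residue c) (+ modulus c) x y ⟩
    (y ℤ.- x) ℤ.* + modulus c              ∎))
  where
  open ≡-Reasoning
  lemma₁ : ∀ z n i k → n ℤ.* k ≡ z ℤ.+ n ℤ.* (i ℤ.+ k) ℤ.- (z ℤ.+ n ℤ.* i)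
  lemma₁ = ℤ-solve-∀
  lemma₂ : ∀ r m x y → r ℤ.+ m ℤ.* y ℤ.- (r ℤ.+ m ℤ.* x) ≡ (y ℤ.- x) ℤ.* m
  lemma₂ = ℤ-solve-∀

-- If z is missed by the classes whose modulus divides n = pᵃm, then the p integers z + nj
-- (0 ≤ j < p) lie in pairwise different classes with modulus pᵃ⁺¹e, e ∣ m.
covering-descent : ∀ {p m ds} → Prime p → ¬ p ∣ m → (∀ {d} → d ∣ m → d ∈ ds) → length ds < p →
                   ∀ a → CoveringNumber (p ^ suc a * m) → CoveringNumber (p ^ a * m)
covering-descent {p} {m} {ds} pp p∤m complete #ds<p a C = record
  { positive = n>0
  ; system   = s′
  ; cover    = cover′
  ; distinct = AllPairs.map⁺ (AllPairs.filter⁺ divides? (AllPairs.map⁻ distinct))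
  ; moduli>1 = All.map⁺ (All.filter⁺ divides? (All.map⁻ moduli>1))
  ; moduli∣n = All.map⁺ (All.all-filter divides? system)
  }
  where
  open CoveringNumber C
  n = p ^ a * m
  divides? : ∀ c → Dec (modulus c ∣ n)
  divides? c = modulus c ∣? n
  s′ = filter divides? system
  n>0 : 0 < n
  n>0 = n≢0⇒n>0 (λ n≡0 → <⇒≢ positive (sym (trans (*-assoc p (p ^ a) m) (trans (cong (p *_) n≡0) (*-zeroʳ p)))))

  -- With a smaller power of `p`, `d` would divide `n`.
  new-modulus : ∀ {d} → d ∣ p ^ suc a * m → ¬ d ∣ n → ∃[ e ] e ∣ m × d ≡ p ^ suc a * e
  new-modulus d∣ d∤n with b , e , b≤1+a , e∣m , refl ← ∣prime^*-split pp (suc a) d∣ with m≤n⇒m<n∨m≡n b≤1+a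
  ... | inj₂ refl  = e , e∣m , refl
  ... | inj₁ b<1+a = contradiction (*-pres-∣ (^-monoʳ-∣ p (≤-pred b<1+a)) e∣m) d∤n

  p∣m*k : ∀ {d e k} → d ∣ n * k → d ≡ p ^ suc a * e → p ∣ m * k
  p∣m*k {_} {e} {k} d∣nk refl = *-cancelˡ-∣ (p ^ a) {{m^n≢0 p a {{prime⇒nonZero pp}}}}
    (m*n∣⇒m∣ _ e (subst₂ _∣_ (cong (_* e) (*-comm p (p ^ a))) (*-assoc (p ^ a) m k) d∣nk))

  module _ (z : ℤ) (z∉ : ¬ Any (z ∈ᶜ_) s′) where
    NewClass : ℕ → Set
    NewClass j = ∃₂ λ c e → c ∈ system × z ℤ.+ + n ℤ.* + j ∈ᶜ c × e ∣ m × modulus c ≡ p ^ suc a * e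

    new-class : ∀ j → NewClass j
    new-class j =
      let c , c∈ , z+nj∈c = find (cover (z ℤ.+ + n ℤ.* + j))
          e , e∣m , eq    = new-modulus (All.lookup moduli∣n (∈-map⁺ modulus c∈))
                              -- A class whose modulus divides `n` would contain `z` along with z +
                              -- nj.
                              (λ c∣n → z∉ (lose (∈-filter⁺ divides? c∈ c∣n) (∈ᶜ-shift {z} {c} n c∣n (+ j) z+nj∈c)))
      in c , e , c∈ , z+nj∈c , e∣m , eq

    position : ∀ {j} → NewClass j → Fin (length ds)
    position (_ , _ , _ , _ , e∣m , _) = Any.index (complete e∣m)

    -- Equal `e` give equal moduli, hence a single class. Its modulus divides n(j - i), so `p`
    -- divides m(j - i), although 0 < j - i < p.
    collision : ∀ {i j} → i < j → j < p → (x : NewClass i) (y : NewClass j) → position x ≡ position y → ⊥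
    collision {i} {j} i<j j<p (c , e , c∈ , i∈c , e∣m , c≡) (c′ , e′ , c′∈ , j∈c′ , e′∣m , c′≡) same =
      [ p∤m , (λ p∣j-i → <⇒≱ (≤-<-trans (m∸n≤m j i) j<p) (∣⇒≤ {{>-nonZero (m<n⇒0<n∸m i<j)}} p∣j-i)) ]′
      (euclidsLemma m (j ∸ i) pp (p∣m*k (∈ᶜ-difference {z} {c} n (<⇒≤ i<j) i∈c
        (subst (z ℤ.+ + n ℤ.* + j ∈ᶜ_) (sym c≡c′) j∈c′)) c≡))
      where
      e≡e′ : e ≡ e′
      e≡e′ = trans (lookup-index (complete e∣m)) (trans (cong (lookup ds) same) (sym (lookup-index (complete e′∣m))))
      c≡c′ : c ≡ c′
      c≡c′ = moduli-injective distinct c∈ c′∈ (trans c≡ (trans (cong (p ^ suc a *_) e≡e′) (sym c′≡)))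

    absurd : ⊥
    absurd = let i , j , i<j , same = pigeonhole #ds<p (λ j → position (new-class (toℕ j)))
             in collision i<j (toℕ<n j) (new-class (toℕ i)) (new-class (toℕ j)) same

  cover′ : IsCover s′
  cover′ z with Any.any? (∈ᶜ? z) s′
  ... | yes z∈ = z∈
  ... | no  z∉ = contradiction (absurd z z∉) id

-- Covers up to the class 0 mod n

record NearCovering (n : ℕ) : Set where
  field
    positive : 0 < n
    system   : System
    cover    : ∀ z → + n ℤᵈ.∣ z ⊎ Any (z ∈ᶜ_) system
    distinct : Unique (moduli system)
    moduli>1 : All (1 <_) (moduli system)
    moduli∣n : All (_∣ n) (moduli system)

progression : ℕ → ℕ → (ms : List ℕ) → All (1 <_) ms → System
progression n i []       []       = []
progression n i (m ∷ ms) (p ∷ ps) = residueClass (+ (n * i)) m (<-trans z<s p) ∷ progression n (suc i) ms ps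

moduli-progression : ∀ n i ms (ps : All (1 <_) ms) → moduli (progression n i ms ps) ≡ ms
moduli-progression n i []       []       = refl
moduli-progression n i (m ∷ ms) (p ∷ ps) = cong (m ∷_) (moduli-progression n (suc i) ms ps)

-- The modulus paired with index `k` divides `N`, so its class contains all of nk mod `N`; the
-- recursion moves `i` up to `k`.
progression-covers : ∀ {N} n i ms (ps : All (1 <_) ms) → All (_∣ N) ms → ∀ w k → i ≤ k → k < i + length ms →
                     Any (+ (n * k) ℤ.+ + N ℤ.* w ∈ᶜ_) (progression n i ms ps)
progression-covers n i [] [] [] w k i≤k k<i = contradiction (≤-trans k<i (≤-reflexive (+-identityʳ i))) (≤⇒≯ i≤k)
progression-covers {N} n i (m ∷ ms) (p ∷ ps) (divides q refl ∷ ∣N) w k i≤k k<i+L with m≤n⇒m<n∨m≡n i≤k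
... | inj₁ i<k  = there (progression-covers n (suc i) ms ps ∣N w k i<k (≤-trans k<i+L (≤-reflexive (+-suc i _))))
... | inj₂ refl = here (+ q ℤ.* w , cong (λ y → + (n * k) ℤ.+ y)
                    (trans (cong (ℤ._* w) (ℤ.pos-* q m)) (lemma (+ q) (+ m) w)))
  where
  lemma : ∀ q m w → q ℤ.* m ℤ.* w ≡ m ℤ.* (q ℤ.* w)
  lemma = ℤ-solve-∀

-- The class 0 mod n splits into the p classes nk mod np (1 ≤ k ≤ p); the k-th of them is
-- covered with the k-th divisor of m, multiplied by pᵃ⁺¹.
module Extension {p m ds} (pp : Prime p) (p∤m : ¬ p ∣ m) (isD : IsDivisorList m ds)
                 (p≤1+#ds : p ≤ suc (length ds)) a (near : NearCovering (p ^ a * m)) where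
  open NearCovering near
  private
    n = p ^ a * m
    N = p ^ suc a * m
    ms = map (p ^ suc a *_) ds
    instance
      _ = prime⇒nonZero pp
      _ = m^n≢0 p (suc a)

    N≡p*n : N ≡ p * n
    N≡p*n = *-assoc p (p ^ a) m

    N>0 : 0 < N
    N>0 = subst (0 <_) (sym N≡p*n) (*-mono-< {0} {p} {0} (<-trans z<s (prime⇒>1 pp)) positive)

    d>0 : ∀ {d} → d ∣ m → 0 < d
    d>0 (divides q refl) = n≢0⇒n>0 (λ { refl → p∤m (subst (p ∣_) (sym (*-zeroʳ q)) (p ∣0)) })

    ms>1 : All (1 <_) ms
    ms>1 = All.map⁺ (All.tabulate λ d∈ → <-≤-trans (prime⇒>1 pp)
      (≤-trans (≤-reflexive (sym (*-identityʳ p)))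
        (≤-trans (*-monoʳ-≤ p (*-mono-≤ (m^n>0 p a) (d>0 (sound isD d∈)))) (≤-reflexive (sym (*-assoc p (p ^ a) _))))))

    ms∣N : All (_∣ N) ms
    ms∣N = All.map⁺ (All.tabulate λ d∈ → *-monoʳ-∣ (p ^ suc a) (sound isD d∈))

  system⁺ : System
  system⁺ = progression n 1 ms ms>1 ++ system

  private
    moduli-system⁺ : moduli system⁺ ≡ ms ++ moduli system
    moduli-system⁺ = trans (map-++ modulus (progression n 1 ms ms>1) system)
      (cong (_++ moduli system) (moduli-progression n 1 ms ms>1))

  distinct⁺ : Unique (moduli system⁺)
  distinct⁺ = subst Unique (sym moduli-system⁺) (Unique.++⁺
    (Unique.map⁺ (λ {x} {y} → *-cancelˡ-≡ x y (p ^ suc a)) (unique isD)) distinct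
    (λ { (d∈ , d∈′) → disjoint d∈ d∈′ }))
    where
    disjoint : ∀ {d} → d ∈ ms → d ∈ moduli system → ⊥
    disjoint d∈ d∈′ with e , _ , refl ← ∈-map⁻ (p ^ suc a *_) d∈ =
      p^[1+a]*e∤p^a*m pp p∤m a e (All.lookup moduli∣n d∈′)

  moduli>1⁺ : All (1 <_) (moduli system⁺)
  moduli>1⁺ = subst (All (1 <_)) (sym moduli-system⁺) (All.++⁺ ms>1 moduli>1)

  moduli∣N⁺ : All (_∣ N) (moduli system⁺)
  moduli∣N⁺ = subst (All (_∣ N)) (sym moduli-system⁺)
    (All.++⁺ ms∣N (All.map (λ d∣n → ∣-trans d∣n (divides p N≡p*n)) moduli∣n))

  -- The inequality in the first alternative lets one case analysis serve both conclusions: it is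
  -- dropped for the near cover and contradicted for the cover.
  cover⁺ : ∀ z → (length ds < p × + N ℤᵈ.∣ z) ⊎ Any (z ∈ᶜ_) system⁺
  cover⁺ z with cover z
  ... | inj₂ z∈ = inj₂ (++⁺ʳ (progression n 1 ms ms>1) z∈)
  ... | inj₁ (ℤᵈ.divides y z≡y*n) = split (k <? suc (length ds))
    where
    -- The shift by 1 puts `k` in the range from 1 to `p`, so that the class that may be left over,
    -- `k` = `p`, is 0 mod `N`.
    r = (y ℤ.- + 1) ℤ.%ℕ p
    w = (y ℤ.- + 1) ℤ./ℕ p
    k = suc r
    k≤p : k ≤ p
    k≤p = ℤ.n%ℕd<d (y ℤ.- + 1) p

    lemma₁ : ∀ y → y ≡ + 1 ℤ.+ (y ℤ.- + 1)
    lemma₁ = ℤ-solve-∀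
    lemma₂ : ∀ k n w p → (+ 1 ℤ.+ (k ℤ.+ w ℤ.* p)) ℤ.* n ≡ n ℤ.* (+ 1 ℤ.+ k) ℤ.+ p ℤ.* n ℤ.* w
    lemma₂ = ℤ-solve-∀
    z≡ : z ≡ + (n * k) ℤ.+ + N ℤ.* w
    z≡ = begin
      z                                           ≡⟨ z≡y*n ⟩
      y ℤ.* + n                                   ≡⟨ cong (ℤ._* + n) (trans (lemma₁ y) (cong (λ x → + 1 ℤ.+ x) (ℤ.a≡a%ℕn+[a/ℕn]*n (y ℤ.- + 1) p))) ⟩
      (+ 1 ℤ.+ (+ r ℤ.+ w ℤ.* + p)) ℤ.* + n       ≡⟨ lemma₂ (+ r) (+ n) w (+ p) ⟩
      + n ℤ.* + k ℤ.+ + p ℤ.* + n ℤ.* w           ≡⟨ cong₂ (λ u v → u ℤ.+ v ℤ.* w) (ℤ.pos-* n k) (trans (cong +_ N≡p*n) (ℤ.pos-* p n)) ⟨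
      + (n * k) ℤ.+ + N ℤ.* w                     ∎
      where open ≡-Reasoning
    split : Dec (k < suc (length ds)) → (length ds < p × + N ℤᵈ.∣ z) ⊎ Any (z ∈ᶜ_) system⁺
    split (yes k≤L) = inj₂ (++⁺ˡ (subst (λ x → Any (x ∈ᶜ_) _) (sym z≡)
      (progression-covers n 1 ms ms>1 ms∣N w k (s≤s z≤n) (≤-trans k≤L (≤-reflexive (cong suc (sym (length-map _ ds))))))))
    split (no k≰L) with k ≟ p
    -- As `p` ≤ 1 + `length ds`, any `k` below `p` has a divisor of its own.
    ... | no  k≢p = contradiction (<-≤-trans (≤∧≢⇒< k≤p k≢p) p≤1+#ds) k≰L
    ... | yes k≡p = inj₁ (≤-trans (≮⇒≥ k≰L) k≤p , ℤᵈ.divides (+ 1 ℤ.+ w) (begin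
      z                                        ≡⟨ z≡ ⟩
      + (n * k) ℤ.+ + N ℤ.* w                  ≡⟨ cong (λ x → + x ℤ.+ + N ℤ.* w) (trans (cong (n *_) k≡p) (trans (*-comm n p) (sym N≡p*n))) ⟩
      + N ℤ.+ + N ℤ.* w                        ≡⟨ lemma₃ (+ N) w ⟩
      (+ 1 ℤ.+ w) ℤ.* + N                      ∎))
      where
      open ≡-Reasoning
      lemma₃ : ∀ N w → N ℤ.+ N ℤ.* w ≡ (+ 1 ℤ.+ w) ℤ.* N
      lemma₃ = ℤ-solve-∀

  extended-near : NearCovering N
  extended-near = record
    { positive = N>0
    ; system   = system⁺
    ; cover    = λ z → [ inj₁ ∘ proj₂ , inj₂ ]′ (cover⁺ z)
    ; distinct = distinct⁺
    ; moduli>1 = moduli>1⁺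
    ; moduli∣n = moduli∣N⁺
    }

  extended-covering : p ≤ length ds → CoveringNumber N
  extended-covering p≤#ds = record
    { positive = N>0
    ; system   = system⁺
    ; cover    = λ z → [ (λ (#ds<p , _) → contradiction p≤#ds (<⇒≱ #ds<p)) , id ]′ (cover⁺ z)
    ; distinct = distinct⁺
    ; moduli>1 = moduli>1⁺
    ; moduli∣n = moduli∣N⁺
    }

-- Every integer is a multiple of 1, so the construction starts from the empty system.
near-1 : NearCovering 1
near-1 = record
  { positive = z<s
  ; system   = []
  ; cover    = λ z → inj₁ (ℤᵈ.divides z (sym (ℤ.*-identityʳ z)))
  ; distinct = []
  ; moduli>1 = []
  ; moduli∣n = []
  }

-- Every power of `p` reuses the same divisors of `m`, so a single bound on `p` suffices for all
-- exponents.
near-prime^* : ∀ {p m ds} → Prime p → ¬ p ∣ m → IsDivisorList m ds → p ≤ suc (length ds) →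
               NearCovering m → ∀ a → NearCovering (p ^ a * m)
near-prime^* pp p∤m isD p≤ near zero    = subst NearCovering (sym (*-identityˡ _)) near
near-prime^* pp p∤m isD p≤ near (suc a) =
  Extension.extended-near pp p∤m isD p≤ a (near-prime^* pp p∤m isD p≤ near a)

-- Numbers given by primes and exponents

-- The largest prime will stand at the head, so that the tail is the part built from the smaller
-- primes.
val : ∀ {k} → Vec ℕ k → Vec ℕ k → ℕ
val []       []       = 1
val (p ∷ ps) (a ∷ as) = p ^ a * val ps as

τ : ∀ {k} → Vec ℕ k → ℕ
τ []       = 1
τ (a ∷ as) = suc a * τ as

divisors : ∀ {k} → Vec ℕ k → Vec ℕ k → List ℕ
divisors []       []       = 1 ∷ []
divisors (p ∷ ps) (a ∷ as) = withPowers p a (divisors ps as)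

DescendingPrimes : ∀ {k} → Vec ℕ k → Set
DescendingPrimes []       = ⊤
DescendingPrimes (p ∷ ps) = Prime p × All (_< p) (toList ps) × DescendingPrimes ps

length-divisors : ∀ {k} (ps as : Vec ℕ k) → length (divisors ps as) ≡ τ as
length-divisors []       []       = refl
length-divisors (p ∷ ps) (a ∷ as) =
  trans (length-withPowers p a (divisors ps as)) (cong (suc a *_) (length-divisors ps as))

prime∣prime⇒≡ : ∀ {p q} → Prime p → Prime q → q ∣ p → q ≡ p
prime∣prime⇒≡ pp pq q∣p with prime⇒irreducible pp q∣p
... | inj₁ refl = contradiction ∣-refl (prime∤1 pq)
... | inj₂ q≡p  = q≡p

prime∣val⇒∈ : ∀ {k q} (ps as : Vec ℕ k) → DescendingPrimes ps → Prime q → q ∣ val ps as → q ∈ toList ps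
prime∣val⇒∈ []       []       _              pq q∣1 = contradiction q∣1 (prime∤1 pq)
prime∣val⇒∈ (p ∷ ps) (a ∷ as) (pp , _ , dps) pq q∣  with euclidsLemma (p ^ a) _ pq q∣
... | inj₁ q∣pᵃ = here (prime∣prime⇒≡ pp pq (prime∣^⇒∣ pq a q∣pᵃ))
... | inj₂ q∣m  = there (prime∣val⇒∈ ps as dps pq q∣m)

head∤val : ∀ {k p} (ps as : Vec ℕ k) → DescendingPrimes (p ∷ ps) → ¬ p ∣ val ps as
head∤val ps as (pp , ps<p , dps) p∣ = <-irrefl refl (All.lookup ps<p (prime∣val⇒∈ ps as dps pp p∣))

divisors-isDivisorList : ∀ {k} (ps as : Vec ℕ k) → DescendingPrimes ps → IsDivisorList (val ps as) (divisors ps as)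
divisors-isDivisorList [] [] _ = record
  { unique   = [] ∷ []
  ; sound    = λ { (here refl) → ∣-refl }
  ; complete = λ d∣1 → here (∣1⇒≡1 d∣1)
  }
divisors-isDivisorList (p ∷ ps) (a ∷ as) d@(pp , _ , dps) =
  withPowers-isDivisorList pp (head∤val ps as d) (divisors-isDivisorList ps as dps) a

∣val⇒val : ∀ {k d} (ps as : Vec ℕ k) → DescendingPrimes ps → d ∣ val ps as →
           ∃[ bs ] Pointwise _≤_ bs as × d ≡ val ps bs
∣val⇒val []       []       _              d∣1 = [] , [] , ∣1⇒≡1 d∣1
∣val⇒val (p ∷ ps) (a ∷ as) (pp , _ , dps) d∣
  with b , e , b≤a , e∣ , refl ← ∣prime^*-split pp a d∣
  with bs , bs≤as , refl ← ∣val⇒val ps as dps e∣ = b ∷ bs , b≤a ∷ bs≤as , refl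

τ-mono : ∀ {k} {bs as : Vec ℕ k} → Pointwise _≤_ bs as → τ bs ≤ τ as
τ-mono []              = ≤-refl
τ-mono (b≤a ∷ bs≤as) = *-mono-≤ (s≤s b≤a) (τ-mono bs≤as)

τ>0 : ∀ {k} (as : Vec ℕ k) → 0 < τ as
τ>0 []       = z<s
τ>0 (a ∷ as) = *-mono-≤ {1} {suc a} (s≤s z≤n) (τ>0 as)

τ-mono-< : ∀ {k} {bs as : Vec ℕ k} → Pointwise _≤_ bs as → bs ≡ as ⊎ τ bs < τ as
τ-mono-< [] = inj₁ refl
τ-mono-< {bs = b ∷ bs} {a ∷ as} (b≤a ∷ bs≤as) with τ-mono-< bs≤as | m≤n⇒m<n∨m≡n b≤a
... | inj₁ refl  | inj₂ refl = inj₁ refl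
... | inj₁ refl  | inj₁ b<a  = inj₂ (*-monoˡ-< (τ bs) {{>-nonZero (τ>0 bs)}} (s<s b<a))
... | inj₂ bs<as | _         = inj₂ (<-≤-trans (*-monoʳ-< (suc b) bs<as) (*-monoˡ-≤ (τ as) (s≤s b≤a)))

-- The condition τₛ < pₛ₊₁ for all s, starting with τ₀ = 1.
Sparse : ∀ {k} → Vec ℕ k → Vec ℕ k → Set
Sparse []       []       = ⊤
Sparse (p ∷ ps) (a ∷ as) = τ as < p × Sparse ps as

sparse-antitone : ∀ {k} (ps : Vec ℕ k) {bs as} → Pointwise _≤_ bs as → Sparse ps as → Sparse ps bs
sparse-antitone []       []            _            = tt
sparse-antitone (p ∷ ps) (_ ∷ bs≤as) (τas<p , sp) = ≤-<-trans (τ-mono bs≤as) τas<p , sparse-antitone ps bs≤as sp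

-- `covering-descent` strips off the powers of the largest prime, then of the next, down to 1, which
-- has no divisor greater than one.
sparse⇒¬covering : ∀ {k} (ps as : Vec ℕ k) → DescendingPrimes ps → Sparse ps as → ¬ CoveringNumber (val ps as)
sparse⇒¬covering [] [] _ _ C = no-class system (cover ℤ.0ℤ) moduli>1 moduli∣n
  where
  open CoveringNumber C
  no-class : ∀ s → Any (ℤ.0ℤ ∈ᶜ_) s → All (1 <_) (moduli s) → All (_∣ 1) (moduli s) → ⊥
  no-class (c ∷ s) _ (1<m ∷ _) (m∣1 ∷ _) = <⇒≢ 1<m (sym (∣1⇒≡1 m∣1))
sparse⇒¬covering (p ∷ ps) (a ∷ as) d@(pp , _ , dps) (τas<p , sp) = strip a
  where
  strip : ∀ a → ¬ CoveringNumber (p ^ a * val ps as)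
  strip zero    C = sparse⇒¬covering ps as dps sp (subst CoveringNumber (*-identityˡ _) C)
  strip (suc a) C = strip a (covering-descent pp (head∤val ps as d)
    (complete (divisors-isDivisorList ps as dps))
    (≤-<-trans (≤-reflexive (length-divisors ps as)) τas<p) a C)

near-cons : ∀ {k p} a (ps as : Vec ℕ k) → DescendingPrimes (p ∷ ps) → p ≤ suc (τ as) →
            NearCovering (val ps as) → NearCovering (val (p ∷ ps) (a ∷ as))
near-cons a ps as d@(pp , _ , dps) p≤1+τ near =
  near-prime^* pp (head∤val ps as d) (divisors-isDivisorList ps as dps)
    (≤-trans p≤1+τ (s≤s (≤-reflexive (sym (length-divisors ps as))))) near a

covering-cons : ∀ {k p} (ps as : Vec ℕ k) → DescendingPrimes (p ∷ ps) → p ≤ τ as →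
                NearCovering (val ps as) → CoveringNumber (val (p ∷ ps) (1 ∷ as))
covering-cons ps as d@(pp , _ , dps) p≤τ near =
  Extension.extended-covering pp (head∤val ps as d) (divisors-isDivisorList ps as dps)
    (m≤n⇒m≤1+n p≤#) 0 (subst NearCovering (sym (*-identityˡ _)) near) p≤#
  where
  p≤# = ≤-trans p≤τ (≤-reflexive (sym (length-divisors ps as)))

-- Chains of primes

-- The invariant of the construction; `next` is chosen but has no exponent yet. By `tight` it is
-- both large enough for `Sparse` and small enough for `near-cons`.
record Chain (k : ℕ) : Set where
  field
    next       : ℕ
    primes     : Vec ℕ k
    exponents  : Vec ℕ k
    descending : DescendingPrimes (next ∷ primes)
    positive   : All (0 <_) (toList exponents)
    tight      : next ≡ suc (τ exponents)
    sparse     : Sparse primes exponents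
    near       : NearCovering (val primes exponents)

descending-cons : ∀ {k p q} {ps : Vec ℕ k} → Prime p → q < p → DescendingPrimes (q ∷ ps) → DescendingPrimes (p ∷ q ∷ ps)
descending-cons pp q<p d@(_ , ps<q , _) = pp , q<p ∷ All.map (λ r<q → <-trans r<q q<p) ps<q , d

-- The quotient is positive because p > 1. Thus p exceeds `m`, and a large `m` forces a large prime.
prime≡1+[1+c]*m : ∀ m → 1 < m → ∃₂ λ c p → Prime p × p ≡ suc (suc c * m)
prime≡1+[1+c]*m m 1<m = nonzeroQuotient (prime≡1[mod] m 1<m)
  where
  nonzeroQuotient : ∃[ p ] Prime p × m ∣ pred p → ∃₂ λ c p → Prime p × p ≡ suc (suc c * m)
  nonzeroQuotient (p , pp , divides zero    p-1≡0) = contradiction (sym p-1≡0) (<⇒≢ (pred-mono-≤ (prime⇒>1 pp)))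
  nonzeroQuotient (p , pp , divides (suc c) eq)    =
    c , p , pp , trans (sym (suc-pred p {{prime⇒nonZero pp}})) (cong suc eq)

chain-zero : Chain 0
chain-zero = record
  { next       = 2
  ; primes     = []
  ; exponents  = []
  ; descending = prime[2] , [] , tt
  ; positive   = []
  ; tight      = refl
  ; sparse     = tt
  ; near       = near-1
  }

chain-suc : ∀ {k} → Chain k → Chain (suc k)
-- The factor 2 makes the modulus exceed 1 and the new exponent 2(1 + c) - 1 positive.
chain-suc ch = extend (prime≡1+[1+c]*m (t * 2) (*-mono-≤ (τ>0 exponents) ≤-refl))
  where
  open Chain ch
  t = τ exponents
  rearrange : ∀ t c → suc c * (t * 2) ≡ suc (suc (c * 2)) * t
  rearrange = solve-∀
  extend : (∃₂ λ c p → Prime p × p ≡ suc (suc c * (t * 2))) → Chain _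
  extend (c , p , pp , p≡) = record
    { next       = p
    ; primes     = next ∷ primes
    ; exponents  = suc (c * 2) ∷ exponents
    ; descending = descending-cons pp next<p descending
    ; positive   = z<s ∷ positive
    ; tight      = p≡1+τ
    ; sparse     = ≤-reflexive (sym tight) , sparse
    ; near       = near-cons (suc (c * 2)) primes exponents descending (≤-reflexive tight) near
    }
    where
    p≡1+τ : p ≡ suc (suc (suc (c * 2)) * t)
    p≡1+τ = trans p≡ (cong suc (rearrange t c))
    next<p : next < p
    next<p = subst₂ _<_ (sym tight) (sym p≡1+τ)
      (s<s (m<m+n t (<-≤-trans (τ>0 exponents) (m≤m+n t _))))

chain : ∀ k → Chain k
chain zero    = chain-zero
chain (suc k) = chain-suc (chain k)

-- Prime divisors and primitivity

val-positive⇒∣ : ∀ {k q} (ps as : Vec ℕ k) → All (0 <_) (toList as) → q ∈ toList ps → q ∣ val ps as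
val-positive⇒∣ (p ∷ ps) (suc a ∷ as) (_ ∷ as>0) (here refl) = ∣m⇒∣m*n _ (m∣m*n (p ^ a))
val-positive⇒∣ (p ∷ ps) (a ∷ as)     (_ ∷ as>0) (there q∈)  = ∣n⇒∣m*n (p ^ a) (val-positive⇒∣ ps as as>0 q∈)

descending⇒prime : ∀ {k q} (ps : Vec ℕ k) → DescendingPrimes ps → q ∈ toList ps → Prime q
descending⇒prime (p ∷ ps) (pp , _ , _)  (here refl) = pp
descending⇒prime (p ∷ ps) (_ , _ , dps) (there q∈)  = descending⇒prime ps dps q∈

descending⇒unique : ∀ {k} (ps : Vec ℕ k) → DescendingPrimes ps → Unique (toList ps)
descending⇒unique []       _                = []
descending⇒unique (p ∷ ps) (_ , ps<p , dps) = All.map >⇒≢ ps<p ∷ descending⇒unique ps dps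

val-hasExactlyPrimeDivisors : ∀ {k} (ps as : Vec ℕ k) → DescendingPrimes ps → All (0 <_) (toList as) →
                              HasExactlyPrimeDivisors k (val ps as)
val-hasExactlyPrimeDivisors ps as dps as>0 =
  toList ps , descending⇒unique ps dps , length-toList ps , λ q → mk⇔
    (λ q∈ → descending⇒prime ps dps q∈ , val-positive⇒∣ ps as as>0 q∈)
    (λ (pq , q∣) → prime∣val⇒∈ ps as dps pq q∣)

-- A proper divisor either loses `p`, leaving a sparse number, or has a smaller exponent elsewhere.
-- Then the part below `p` has at most α · `τ as` = `p` - 1 divisors, and the whole is sparse.
proper⇒¬covering : ∀ {k p q α d} (ps as : Vec ℕ k) → DescendingPrimes (p ∷ q ∷ ps) → Sparse (q ∷ ps) (α ∷ as) →
                   p ≡ suc (α * τ as) → τ as ≤ α →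
                   ProperDivisor d (val (p ∷ q ∷ ps) (1 ∷ α ∷ as)) → ¬ CoveringNumber d
proper⇒¬covering {q = q} {α} ps as dps sp refl τ≤α (_ , d∣n , d<n) C
  with ∣val⇒val (_ ∷ q ∷ ps) (1 ∷ α ∷ as) dps d∣n
... | zero ∷ β ∷ bs , _ ∷ le , refl =
  sparse⇒¬covering (q ∷ ps) (β ∷ bs) (proj₂ (proj₂ dps)) (sparse-antitone (q ∷ ps) le sp)
    (subst CoveringNumber (*-identityˡ _) C)
... | suc zero ∷ β ∷ bs , _ ∷ le@(β≤α ∷ bs≤as) , refl =
  sparse⇒¬covering (_ ∷ q ∷ ps) (1 ∷ β ∷ bs) dps (s≤s few , sparse-antitone (q ∷ ps) le sp) C
  where
  few : suc β * τ bs ≤ α * τ as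
  few with m≤n⇒m<n∨m≡n β≤α | τ-mono-< bs≤as
  ... | inj₁ β<α  | _          = *-mono-≤ β<α (τ-mono bs≤as)
  -- Keeping `α` loses at least one of the `τ as` divisors, each counted 1 + `α` times; `τ as` ≤ `α`
  -- makes up for the extra 1.
  ... | inj₂ refl | inj₁ refl  = contradiction refl (<⇒≢ d<n)
  ... | inj₂ refl | inj₂ bs<as = begin
    τ bs + α * τ bs ≤⟨ +-monoˡ-≤ (α * τ bs) (≤-trans (<⇒≤ bs<as) τ≤α) ⟩
    α + α * τ bs    ≡⟨ *-suc α (τ bs) ⟨
    α * suc (τ bs)  ≤⟨ *-monoʳ-≤ α bs<as ⟩
    α * τ as        ∎
    where open ≤-Reasoning
... | suc (suc _) ∷ _ , s≤s () ∷ _ , _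

chain⇒primitiveCovering : ∀ {k} → Chain k → ∀ N →
  ∃[ n ] N < n × PrimitiveCoveringNumber n × HasExactlyPrimeDivisors (suc (suc k)) n
chain⇒primitiveCovering ch N =
  -- The factor `t` turns the prime into 1 + αt; the other factor makes `α` at least `t`, as
  -- primitivity requires, and greater than `N`.
  finish (prime≡1+[1+c]*m (t * (t + suc N)) (*-mono-≤ t>0 (+-mono-≤ t>0 (s≤s z≤n))))
  where
  open Chain ch
  t = τ exponents
  t>0 : 0 < t
  t>0 = τ>0 exponents
  rearrange : ∀ t N c → suc c * (t * (t + suc N)) ≡ suc c * (t + suc N) * t
  rearrange = solve-∀
  finish : (∃₂ λ c p → Prime p × p ≡ suc (suc c * (t * (t + suc N)))) →
           ∃[ n ] N < n × PrimitiveCoveringNumber n × HasExactlyPrimeDivisors _ n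
  finish (c , p , pp , p≡suc) = n , N<n ,
    (covering , λ _ → proper⇒¬covering primes exponents dps (≤-reflexive (sym tight) , sparse) p≡ t≤α) ,
    val-hasExactlyPrimeDivisors (p ∷ next ∷ primes) (1 ∷ α ∷ exponents) dps exponents>0
    where
    α = suc c * (t + suc N)
    n = val (p ∷ next ∷ primes) (1 ∷ α ∷ exponents)
    p≡ : p ≡ suc (α * t)
    p≡ = trans p≡suc (cong suc (rearrange t N c))
    t+1+N≤α : t + suc N ≤ α
    t+1+N≤α = m≤m+n (t + suc N) _
    t≤α : t ≤ α
    t≤α = ≤-trans (m≤m+n t _) t+1+N≤α
    α<p : α < p
    α<p = ≤-trans (s≤s (≤-trans (≤-reflexive (sym (*-identityʳ α))) (*-monoʳ-≤ α t>0))) (≤-reflexive (sym p≡))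
    next<p : next < p
    next<p = ≤-<-trans (≤-trans (≤-reflexive tight)
      (≤-trans (s≤s (m≤m+n t N)) (≤-trans (≤-reflexive (sym (+-suc t N))) t+1+N≤α))) α<p
    dps : DescendingPrimes (p ∷ next ∷ primes)
    dps = descending-cons pp next<p descending
    exponents>0 : All (0 <_) (1 ∷ α ∷ toList exponents)
    exponents>0 = z<s ∷ ≤-trans t>0 t≤α ∷ positive
    covering : CoveringNumber n
    covering = covering-cons (next ∷ primes) (α ∷ exponents) dps
      -- 1 + αt ≤ t + αt, the number of divisors below `p`.
      (≤-trans (≤-reflexive p≡) (+-monoˡ-≤ (α * t) t>0))
      (near-cons α primes exponents descending (≤-reflexive tight) near)
    N<n : N < n
    N<n = <-≤-trans (<-trans (≤-trans (m≤n+m (suc N) t) t+1+N≤α) α<p)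
      (∣⇒≤ {{>-nonZero (CoveringNumber.positive covering)}}
        (val-positive⇒∣ (p ∷ next ∷ primes) (1 ∷ α ∷ exponents) exponents>0 (here refl)))

corollary1p2 : ∀ (r : ℕ) → 2 ≤ r →
    InfinitelyMany (λ n → PrimitiveCoveringNumber n × HasExactlyPrimeDivisors r n)
corollary1p2 (suc (suc k)) _ = chain⇒primitiveCovering (chain k)
corollary1p2 (suc zero) (s≤s ())
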